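{- Let $\mathcal{K}\subseteq\mathcal{L}$ be a fuzzy language over $E$. Let $\mathscr{CN}(\mathcal{K})$ be the set of all fuzzy languages $\mathcal{M}\subseteq\mathcal{K}$ over $E$ that are controllable and normal, and let $\mathcal{K}^{\uparrow(CN)}=\bigcup_{\mathcal{M}\in\mathscr{CN}(\mathcal{K})}\mathcal{M}$. Then $\mathcal{K}^{\uparrow(CN)}$ is the largest controllable and normal fuzzy sublanguage of $\mathcal{K}$; that is, $\mathcal{K}^{\uparrow(CN)}\in\mathscr{CN}(\mathcal{K})$ and $\mathcal{M}\subseteq\mathcal{K}^{\uparrow(CN)}$ for every $\mathcal{M}\in\mathscr{CN}(\mathcal{K})$.
   Context: $E$ is a finite set of events and $E^*$ is the set of all finite strings over $E$, including the empty string $\epsilon$. On $[0,1]$, $\wedge$ denotes infimum and $\vee$ supremum. A fuzzy subset of a set $X$ is a function $X\to[0,1]$; $\mathcal{F}(X)$ is the set of all of them; $\mathcal{A}\subseteq\mathcal{B}$ means $\mathcal{A}(x)\le\mathcal{B}(x)$ for all $x$; unions and intersections are pointwise suprema and infima. A fuzzy language over $E$ is an $\mathcal{A}\in\mathcal{F}(E^*)$ which is either the empty fuzzy language $\mathcal{O}$ (identically $0$), or satisfies $\mathcal{A}(\epsilon)=1$ and $\mathcal{A}(\mu)\ge\mathcal{A}(\mu\nu)$ for all $\mu,\nu\in E^*$. $\mathcal{L}$ is a fixed fuzzy language over $E$ (the behavior of the uncontrolled system). Note $\mathcal{O}\in\mathscr{CN}(\mathcal{K})$. The event set is partitioned as $E=E_c\,\dot\cup\,E_{uc}$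 (controllable, uncontrollable) and, independently, as $E=E_o\,\dot\cup\,E_{uo}$ (observable, unobservable). The natural projection $P:E^*\to E_o^*$ erases unobservable events: $P(\epsilon)=\epsilon$, $P(sa)=P(s)P(a)$, where $P(a)=a$ if $a\in E_o$ and $P(a)=\epsilon$ if $a\in E_{uo}$. Define $\mathcal{P}:\mathcal{F}(E^*)\to\mathcal{F}(E_o^*)$ by $\mathcal{P}(\mathcal{A})(\omega)=\vee_{P(\omega')=\omega}\mathcal{A}(\omega')$ and $\mathcal{P}^{ -1}:\mathcal{F}(E_o^*)\to\mathcal{F}(E^*)$ by $\mathcal{P}^{ -1}(\mathcal{B})(\omega)=\mathcal{B}(P(\omega))$. A fuzzy language $\mathcal{M}\subseteq\mathcal{L}$ is controllable (with respect to $\mathcal{L}$ and $E_{uc}$) if $\mathcal{M}(sa)=\mathcal{M}(s)\wedge\mathcal{L}(sa)$ for all $s\in E^*$ and $a\in E_{uc}$. It is normal (with respect to $\mathcal{L}$ and $P$) if $\mathcal{M}=\mathcal{P}^{ -1}[\mathcal{P}(\mathcal{M})]\cap\mathcal{L}$. -}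

module Defs where

open import Axiom.ExcludedMiddle using (ExcludedMiddle)
open import Data.Bool using (Bool; T; not) renaming (_∧_ to _∧ᵇ_; _∨_ to _∨ᵇ_)
open import Data.Bool.Properties using (T-∧; T-∨; T?)
open import Data.List using (List; []; [_]; _++_; _∷ʳ_; concatMap)
open import Data.Product using (∃; _×_; _,_; proj₁; proj₂)
open import Data.Rational using (ℚ; 0ℚ; 1ℚ; _<_; _<?_; _-_)
open import Data.Rational.Properties using (<-dense; <-trans; <-irrefl; <-cmp; +-monoʳ-<; +-identityʳ)
open import Data.Sum using (_⊎_; inj₁; inj₂)
open import Function using (_∘_; Equivalence)
open import Level using (0ℓ)
open import Relation.Binary using (tri<; tri≈; tri>)
open import Relation.Binary.PropositionalEquality using (_≡_; refl; subst)
open import Relation.Nullary using (¬_; yes; no)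
open import Relation.Nullary.Decidable using (⌊_⌋; toWitness; fromWitness)

open Equivalence using (to; from)

-- A real x is the lower Dedekind cut { q ∈ ℚ ∣ q < x }.  Under excluded
-- middle every subset of ℚ has a Bool-valued characteristic function, so
-- these are the usual reals; unlike cuts valued in Set, they form a small
-- type, so that suprema can range over sets of fuzzy languages.

record ℝ : Set where
  field
    below     : ℚ → Bool
    inhabited : ∃ λ q → T (below q)
    bounded   : ∃ λ q → ¬ T (below q)
    lower     : ∀ {p q} → p < q → T (below q) → T (below p)
    rounded   : ∀ {p} → T (below p) → ∃ λ q → p < q × T (below q)

open ℝ public

infix 4 _≤ᴿ_

_≤ᴿ_ : ℝ → ℝ → Set
x ≤ᴿ y = ∀ q → T (below x q) → T (below y q)

fromℚ : ℚ → ℝ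
fromℚ r = record
  { below     = λ q → ⌊ q <? r ⌋
  ; inhabited = r - 1ℚ , fromWitness (subst (r - 1ℚ <_) (+-identityʳ r) (+-monoʳ-< r (toWitness {a? = (0ℚ - 1ℚ) <? 0ℚ} _)))
  ; bounded   = r , λ t → <-irrefl refl (toWitness t)
  ; lower     = λ p<q t → fromWitness (<-trans p<q (toWitness t))
  ; rounded   = λ t → let (m , p<m , m<r) = <-dense (toWitness t)
                      in m , p<m , fromWitness m<r
  }

record 𝕀 : Set where
  constructor interval
  field
    value : ℝ
    0≤    : fromℚ 0ℚ ≤ᴿ value
    ≤1    : value ≤ᴿ fromℚ 1ℚ

open 𝕀 public

infix 4 _≤_ _≈_

_≤_ : 𝕀 → 𝕀 → Set
x ≤ y = value x ≤ᴿ value y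

_≈_ : 𝕀 → 𝕀 → Set
x ≈ y = x ≤ y × y ≤ x

𝟎 : 𝕀
𝟎 = interval (fromℚ 0ℚ) (λ _ t → t)
  λ _ t → fromWitness (<-trans (toWitness t) (toWitness {a? = 0ℚ <? 1ℚ} _))

𝟏 : 𝕀
𝟏 = interval (fromℚ 1ℚ)
  (λ _ t → fromWitness (<-trans (toWitness t) (toWitness {a? = 0ℚ <? 1ℚ} _)))
  (λ _ t → t)

infixr 7 _∧_

_∧_ : 𝕀 → 𝕀 → 𝕀
x ∧ y = interval
  (record
    { below     = λ q → below X q ∧ᵇ below Y q
    ; inhabited = 0ℚ - 1ℚ , from T-∧ (0≤ x (0ℚ - 1ℚ) _ , 0≤ y (0ℚ - 1ℚ) _)
    ; bounded   = let (q , ¬q) = bounded X in q , ¬q ∘ proj₁ ∘ to T-∧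
    ; lower     = λ p<q t → let (tx , ty) = to T-∧ t
                            in from T-∧ (lower X p<q tx , lower Y p<q ty)
    ; rounded   = round
    })
  (λ q t → from T-∧ (0≤ x q t , 0≤ y q t))
  (λ q t → ≤1 x q (proj₁ (to T-∧ t)))
  where
  X = value x
  Y = value y
  round : ∀ {p} → T (below X p ∧ᵇ below Y p) →
          ∃ λ q → p < q × T (below X q ∧ᵇ below Y q)
  round t with to T-∧ t
  ... | tx , ty with rounded X tx | rounded Y ty
  ... | q , p<q , tq | r , p<r , tr with <-cmp q r
  ... | tri< q<r _ _    = q , p<q , from T-∧ (tq , lower Y q<r tr)
  ... | tri≈ _ refl _   = q , p<q , from T-∧ (tq , tr)
  ... | tri> _ _ r<q    = r , p<r , from T-∧ (lower X r<q tq , tr)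

∧-lower₁ : ∀ x y → x ∧ y ≤ x
∧-lower₁ x y q = proj₁ ∘ to (T-∧ {below (value x) q})

∧-lower₂ : ∀ x y → x ∧ y ≤ y
∧-lower₂ x y q = proj₂ ∘ to (T-∧ {below (value x) q})

∧-greatest : ∀ x y z → z ≤ x → z ≤ y → z ≤ x ∧ y
∧-greatest x y z z≤x z≤y q t = from (T-∧ {below (value x) q}) (z≤x q t , z≤y q t)

-- The rationals q < 0 are added so that the supremum of the empty family
-- is 0; for all other families they are already present.

⋁ : ExcludedMiddle 0ℓ → {I : Set} → (I → 𝕀) → 𝕀
⋁ lem {I} f = interval
  (record
    { below     = sup
    ; inhabited = 0ℚ - 1ℚ , _
    ; bounded   = 1ℚ , λ t → <-irrefl refl (toWitness {a? = 1ℚ <? 1ℚ} (sup≤1 1ℚ t))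
    ; lower     = low
    ; rounded   = round
    })
  (λ q t → from (T-∨ {⌊ q <? 0ℚ ⌋}) (inj₁ t))
  sup≤1
  where
  member : ℚ → Set
  member q = ∃ λ i → T (below (value (f i)) q)

  sup : ℚ → Bool
  sup q = ⌊ q <? 0ℚ ⌋ ∨ᵇ ⌊ lem {member q} ⌋

  split : ∀ {q} → T (sup q) → q < 0ℚ ⊎ member q
  split {q} t with to (T-∨ {⌊ q <? 0ℚ ⌋}) t
  ... | inj₁ u = inj₁ (toWitness u)
  ... | inj₂ u = inj₂ (toWitness u)

  neg : ∀ {q} → q < 0ℚ → T (sup q)
  neg {q} q<0 = from (T-∨ {⌊ q <? 0ℚ ⌋}) (inj₁ (fromWitness q<0))

  mem : ∀ {q} → member q → T (sup q)
  mem {q} m = from (T-∨ {⌊ q <? 0ℚ ⌋}) (inj₂ (fromWitness m))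

  sup≤1 : ∀ q → T (sup q) → T ⌊ q <? 1ℚ ⌋
  sup≤1 q t with split t
  ... | inj₁ q<0     = ≤1 𝟎 q (fromWitness q<0)
  ... | inj₂ (i , u) = ≤1 (f i) q u

  low : ∀ {p q} → p < q → T (sup q) → T (sup p)
  low p<q t with split t
  ... | inj₁ q<0     = neg (<-trans p<q q<0)
  ... | inj₂ (i , u) = mem (i , lower (value (f i)) p<q u)

  round : ∀ {p} → T (sup p) → ∃ λ q → p < q × T (sup q)
  round t with split t
  ... | inj₁ p<0     = let (q , p<q , q<0) = <-dense p<0 in q , p<q , neg q<0
  ... | inj₂ (i , u) = let (q , p<q , v) = rounded (value (f i)) u
                       in q , p<q , mem (i , v)

⋁-upper : (lem : ExcludedMiddle 0ℓ) {I : Set} (f : I → 𝕀) → ∀ i → f i ≤ ⋁ lem f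
⋁-upper lem f i q t = from (T-∨ {⌊ q <? 0ℚ ⌋}) (inj₂ (fromWitness (i , t)))

⋁-least : (lem : ExcludedMiddle 0ℓ) {I : Set} (f : I → 𝕀) →
          ∀ y → (∀ i → f i ≤ y) → ⋁ lem f ≤ y
⋁-least lem f y f≤y q t with to (T-∨ {⌊ q <? 0ℚ ⌋}) t
... | inj₁ u = 0≤ y q u
... | inj₂ u = let (i , v) = toWitness u in f≤y i q v

ℱ : Set → Set
ℱ X = X → 𝕀

infix 4 _⊆_ _≐_
infixr 7 _∩_

_⊆_ : {X : Set} → ℱ X → ℱ X → Set
A ⊆ B = ∀ x → A x ≤ B x

_≐_ : {X : Set} → ℱ X → ℱ X → Set
A ≐ B = ∀ x → A x ≈ B x

_∩_ : {X : Set} → ℱ X → ℱ X → ℱ X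
(A ∩ B) x = A x ∧ B x

⋃ : ExcludedMiddle 0ℓ → {X : Set} → (ℱ X → Set) → ℱ X
⋃ lem 𝒮 x = ⋁ lem {∃ λ M → 𝒮 M} (λ (M , _) → M x)

𝒪 : {E : Set} → ℱ (List E)
𝒪 _ = 𝟎

IsFuzzyLanguage : {E : Set} → ℱ (List E) → Set
IsFuzzyLanguage A =
  A ≐ 𝒪 ⊎ (A [] ≈ 𝟏 × (∀ μ ν → A (μ ++ ν) ≤ A μ))

-- A partition of E into two parts is a map E → Bool: E_c and E_o are where
-- c and o are true, E_uc and E_uo where they are false.

Part : {E : Set} → (E → Bool) → Set
Part o = ∃ λ a → T (o a)

project₁ : {E : Set} (o : E → Bool) → E → List (Part o)
project₁ o a with T? (o a)
... | yes a∈Eₒ = [ a , a∈Eₒ ]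
... | no  _    = []

P : {E : Set} (o : E → Bool) → List E → List (Part o)
P o = concatMap (project₁ o)

𝒫 : ExcludedMiddle 0ℓ → {E : Set} (o : E → Bool) → ℱ (List E) → ℱ (List (Part o))
𝒫 lem o A ω = ⋁ lem {∃ λ ω′ → P o ω′ ≡ ω} (λ (ω′ , _) → A ω′)

𝒫⁻¹ : {E : Set} (o : E → Bool) → ℱ (List (Part o)) → ℱ (List E)
𝒫⁻¹ o B ω = B (P o ω)

Controllable : {E : Set} (c : E → Bool) (L : ℱ (List E)) → ℱ (List E) → Set
Controllable c L M =
  ∀ s a → T (not (c a)) → M (s ∷ʳ a) ≈ M s ∧ L (s ∷ʳ a)

Normal : ExcludedMiddle 0ℓ → {E : Set} (o : E → Bool) (L : ℱ (List E)) → ℱ (List E) → Set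
Normal lem o L M = M ≐ 𝒫⁻¹ o (𝒫 lem o M) ∩ L

record CN (lem : ExcludedMiddle 0ℓ) {E : Set} (c o : E → Bool) (L K M : ℱ (List E)) : Set where
  field
    isFuzzyLanguage : IsFuzzyLanguage M
    M⊆K             : M ⊆ K
    controllable    : Controllable c L M
    normal          : Normal lem o L M

supCN : ExcludedMiddle 0ℓ → {E : Set} (c o : E → Bool) (L K : ℱ (List E)) → ℱ (List E)
supCN lem c o L K = ⋃ lem (CN lem c o L K)

{-# OPTIONS --safe #-}
module Submission where

open import Defs
open import Axiom.ExcludedMiddle using (ExcludedMiddle)
open import Data.Bool using (Bool)
open import Data.Bool.Properties using (T-∧; T-∨)
open import Data.Empty using (⊥-elim)
open import Data.Fin using (Fin)
open import Data.List using (List; []; _++_; _∷ʳ_)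
open import Data.Product using (∃; _×_; _,_; proj₁; proj₂)
open import Data.Rational using (0ℚ; _<?_)
open import Data.Sum using (inj₁; inj₂)
open import Function using (_∘_; Equivalence)
open import Function.Bundles using (_↔_)
open import Level using (0ℓ)
open import Relation.Binary.PropositionalEquality using (refl)
open import Relation.Nullary using (yes; no)
open import Relation.Nullary.Decidable using (⌊_⌋; toWitness)

open Equivalence using (to; from)

-- Every condition defining CN survives unions.  The inequalities bounding a
-- value from below by a meet pass to suprema because [0,1] is a frame: ∧
-- distributes over arbitrary ⋁.

-- Maximality is immediate, since a union lies above its members; the work is to show that the union
-- belongs to the family. Controllability and normality are equations between a value and a meet.
-- One half of each needs only monotonicity, together with the fact that normal languages lie below
-- `L`. The other half has a supremum inside a meet on the left: `⋁-∧-least` reduces it to a single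
-- member `M`, whose own equation gives the bound, so different members never have to be compared.

≤-trans : ∀ x y z → x ≤ y → y ≤ z → x ≤ z
≤-trans x y z x≤y y≤z q = y≤z q ∘ x≤y q

∧-monoˡ : ∀ x y z → x ≤ y → x ∧ z ≤ y ∧ z
∧-monoˡ x y z x≤y = ∧-greatest y z (x ∧ z)
  (≤-trans (x ∧ z) x y (∧-lower₁ x z) x≤y) (∧-lower₂ x z)

-- The frame law in elimination form. On cuts it is elementary: a rational in the cut of the meet
-- lies in both cuts, and lying in that of the supremum it lies in that of some `f i`.
⋁-∧-least : (lem : ExcludedMiddle 0ℓ) {I : Set} (f : I → 𝕀) →
            ∀ y z → (∀ i → f i ∧ y ≤ z) → ⋁ lem f ∧ y ≤ z
⋁-∧-least lem f y z f∧y≤z q t with to (T-∧ {below (value (⋁ lem f)) q}) t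
... | t⋁ , ty with to (T-∨ {⌊ q <? 0ℚ ⌋}) t⋁
-- A negative rational is in every supremum by convention and yields no index, but it is below `z`
-- anyway.
... | inj₁ u = 0≤ z q u
... | inj₂ u = let (i , v) = toWitness u
               in f∧y≤z i q (from (T-∧ {below (value (f i)) q}) (v , ty))

-- Covers the empty language too, which is constant, so that unions need no case distinction on
-- their members.
prefix-antitone : {E : Set} (A : ℱ (List E)) → IsFuzzyLanguage A →
                  ∀ μ ν → A (μ ++ ν) ≤ A μ
prefix-antitone A (inj₁ A≐𝒪) μ ν =
  ≤-trans (A (μ ++ ν)) 𝟎 (A μ) (proj₁ (A≐𝒪 (μ ++ ν))) (proj₂ (A≐𝒪 μ))
prefix-antitone A (inj₂ (_ , anti)) = anti

module _ (lem : ExcludedMiddle 0ℓ) {X : Set} (𝒮 : ℱ X → Set) where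

  ⋃-upper : ∀ M → 𝒮 M → M ⊆ ⋃ lem 𝒮
  ⋃-upper M M∈𝒮 x = ⋁-upper lem (λ (M , _) → M x) (M , M∈𝒮)

  ⋃-least : ∀ x y → (∀ M → 𝒮 M → M x ≤ y) → ⋃ lem 𝒮 x ≤ y
  ⋃-least x y M≤y = ⋁-least lem (λ (M , _) → M x) y (λ (M , M∈𝒮) → M≤y M M∈𝒮)

  ⋃-∧-least : ∀ x y z → (∀ M → 𝒮 M → M x ∧ y ≤ z) → ⋃ lem 𝒮 x ∧ y ≤ z
  ⋃-∧-least x y z M∧y≤z =
    ⋁-∧-least lem (λ (M , _) → M x) y z (λ (M , M∈𝒮) → M∧y≤z M M∈𝒮)

module _ (lem : ExcludedMiddle 0ℓ) {E : Set} (𝒮 : ℱ (List E) → Set) where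

  private
    S : ℱ (List E)
    S = ⋃ lem 𝒮

  -- If some member has value 1 at the empty string, so does the union. Otherwise every member is
  -- `𝒪`, and hence so is the union, even of an empty family.
  ⋃-isFuzzyLanguage : (∀ M → 𝒮 M → IsFuzzyLanguage M) → IsFuzzyLanguage S
  ⋃-isFuzzyLanguage lang with lem {∃ λ M → 𝒮 M × M [] ≈ 𝟏}
  ... | yes (M , M∈𝒮 , _ , 1≤M[]) =
    inj₂ ((≤1 (S []) , ≤-trans 𝟏 (M []) (S []) 1≤M[] (⋃-upper lem 𝒮 M M∈𝒮 [])) , anti)
    where
    anti : ∀ μ ν → S (μ ++ ν) ≤ S μ
    anti μ ν = ⋃-least lem 𝒮 (μ ++ ν) (S μ) λ M M∈𝒮 →
      ≤-trans (M (μ ++ ν)) (M μ) (S μ)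
        (prefix-antitone M (lang M M∈𝒮) μ ν) (⋃-upper lem 𝒮 M M∈𝒮 μ)
  ... | no ∄ = inj₁ λ x → ⋃-least lem 𝒮 x 𝟎 (M≤𝟎 x) , 0≤ (S x)
    where
    M≤𝟎 : ∀ x M → 𝒮 M → M x ≤ 𝟎
    M≤𝟎 x M M∈𝒮 with lang M M∈𝒮
    ... | inj₁ M≐𝒪        = proj₁ (M≐𝒪 x)
    ... | inj₂ (M[]≈𝟏 , _) = ⊥-elim (∄ (M , M∈𝒮 , M[]≈𝟏))

  ⋃-controllable : (c : E → Bool) (L : ℱ (List E)) →
                   (∀ M → 𝒮 M → Controllable c L M) → Controllable c L S
  ⋃-controllable c L ctrl s a a∈Eᵤ = ⋃-least lem 𝒮 sa (S s ∧ L sa) Msa≤Ss∧Lsa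
                                   , ⋃-∧-least lem 𝒮 s (L sa) (S sa) Ms∧Lsa≤Ssa
    where
    sa : List E
    sa = s ∷ʳ a

    Msa≤Ss∧Lsa : ∀ M → 𝒮 M → M sa ≤ S s ∧ L sa
    Msa≤Ss∧Lsa M M∈𝒮 = ≤-trans (M sa) (M s ∧ L sa) (S s ∧ L sa)
      (proj₁ (ctrl M M∈𝒮 s a a∈Eᵤ))
      (∧-monoˡ (M s) (S s) (L sa) (⋃-upper lem 𝒮 M M∈𝒮 s))

    Ms∧Lsa≤Ssa : ∀ M → 𝒮 M → M s ∧ L sa ≤ S sa
    Ms∧Lsa≤Ssa M M∈𝒮 = ≤-trans (M s ∧ L sa) (M sa) (S sa)
      (proj₂ (ctrl M M∈𝒮 s a a∈Eᵤ)) (⋃-upper lem 𝒮 M M∈𝒮 sa)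

  ⋃-normal : (o : E → Bool) (L : ℱ (List E)) →
             (∀ M → 𝒮 M → Normal lem o L M) → Normal lem o L S
  ⋃-normal o L norm ω =
      ∧-greatest (𝒫S (P o ω)) (L ω) (S ω)
        -- The string `ω` lies in its own fibre of the projection.
        (⋁-upper lem (λ (ω′ , _) → S ω′) (ω , refl))
        (⋃-least lem 𝒮 ω (L ω) M≤L)
    -- Two nested suprema are opened, over the fibre of `P o ω` and over `𝒮`. For fixed `ω′` and
    -- `M`, the value `M ω′` is one of those defining `𝒫M M`, because `ω′` and `ω` have the same
    -- projection; normality of `M` then leads back to `M ω`.
    , ⋁-∧-least lem (λ (ω′ , _) → S ω′) (L ω) (S ω) λ (ω′ , Pω′≡Pω) →
        ⋃-∧-least lem 𝒮 ω′ (L ω) (S ω) λ M M∈𝒮 →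
          ≤-trans (M ω′ ∧ L ω) (M ω) (S ω)
            (≤-trans (M ω′ ∧ L ω) (𝒫M M ∧ L ω) (M ω)
              (∧-monoˡ (M ω′) (𝒫M M) (L ω)
                (⋁-upper lem (λ (ω″ , _) → M ω″) (ω′ , Pω′≡Pω)))
              (proj₂ (norm M M∈𝒮 ω)))
            (⋃-upper lem 𝒮 M M∈𝒮 ω)
    where
    𝒫S : ℱ (List (Part o))
    𝒫S = 𝒫 lem o S

    𝒫M : ℱ (List E) → 𝕀
    𝒫M M = 𝒫 lem o M (P o ω)

    M≤L : ∀ M → 𝒮 M → M ω ≤ L ω
    M≤L M M∈𝒮 = ≤-trans (M ω) (𝒫M M ∧ L ω) (L ω)
      (proj₁ (norm M M∈𝒮 ω)) (∧-lower₂ (𝒫M M) (L ω))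

proposition8 : (lem : ExcludedMiddle 0ℓ)
    (E : Set) (finite : ∃ λ n → E ↔ Fin n)
    (c o : E → Bool)
    (L : ℱ (List E)) → IsFuzzyLanguage L →
    (K : ℱ (List E)) → IsFuzzyLanguage K → K ⊆ L →
    CN lem c o L K (supCN lem c o L K)
    × (∀ M → CN lem c o L K M → M ⊆ supCN lem c o L K)
proposition8 lem E _ c o L _ K _ _ =
    record
      { isFuzzyLanguage = ⋃-isFuzzyLanguage lem 𝒮 λ _ → CN.isFuzzyLanguage
      ; M⊆K             = λ x → ⋃-least lem 𝒮 x (K x) λ _ M∈𝒮 → CN.M⊆K M∈𝒮 x
      ; controllable    = ⋃-controllable lem 𝒮 c L λ _ → CN.controllable
      ; normal          = ⋃-normal lem 𝒮 o L λ _ → CN.normal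
      }
  , ⋃-upper lem 𝒮
  where
  𝒮 : ℱ (List E) → Set
  𝒮 = CN lem c o L K
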